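{- Let $\nu=\nu_1\nu_2\cdots\nu_{k-1}$ be a word of distinct integers in $[k]$, and let $r$ be the unique element of $[k]\setminus\{\nu_1,\ldots,\nu_{k-1}\}$. Let $\alpha=(\nu;\,r\to\nu_i)$, where $i\in[k-1]$ is such that $r>\nu_i$ and $r<\max(\nu_{i+1},\nu_{i+2},\ldots,\nu_{k-1})$ (in particular $i\le k-2$). Then $\alpha\sim\alpha^{r}$, where $\alpha^{r}$ denotes the reverse of the arrow pattern $\alpha$ (the superscript $r$ is not the integer $r$).
   Context: $[n]=\{1,\dots,n\}$, and $\mathcal{S}_n$ is the set of permutations $\pi=\pi_1\pi_2\cdots\pi_n$ of $[n]$ in one-line notation. The permutation $\hat\pi$: for $\pi\in\mathcal{S}_n$, $\hat\pi\in\mathcal{S}_n$ is the permutation whose cycle form is obtained from the word $\pi_1\cdots\pi_n$ by inserting a left parenthesis before each left-to-right maximum (an entry larger than all entries to its left) and a right parenthesis immediately before the next left-to-right maximum, or at the end of the word. A cycle $(c_1,c_2,\dots,c_s)$ means $c_1\mapsto c_2\mapsto\cdots\mapsto c_s\mapsto c_1$. Example: if $\pi=2537164$ then $\hat\pi=(2)(53)(7164)$. Arrow patterns: an arrow pattern of size $k$ is a pair $(\nu;H)$ where $\nu=\nu_1\cdots\nu_m$ is a word of distinct positive integers, $H$ is a collection of arrows $b_i\to c_i$, and the set of all integers appearing in $\nu$ or $H$ is $[k]$. A permutation $\pi\in\mathcal{S}_n$ contains $(\nu;H)$ if there are a set $X=\{x_1<x_2<\cdots<x_k\}\subseteq[n]$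 and indices $t_1<\cdots<t_m$ such that $\pi_{t_1}\pi_{t_2}\cdots\pi_{t_m}=x_{\nu_1}x_{\nu_2}\cdots x_{\nu_m}$ and $\hat\pi(x_{b_i})=x_{c_i}$ for every arrow $b_i\to c_i$ in $H$. Otherwise $\pi$ avoids $(\nu;H)$. $\mathcal{S}_n(\nu;H)$ is the set of permutations in $\mathcal{S}_n$ avoiding $(\nu;H)$. Two arrow patterns $\alpha,\beta$ are arrow-Wilf-equivalent, written $\alpha\sim\beta$, if $|\mathcal{S}_n(\alpha)|=|\mathcal{S}_n(\beta)|$ for all $n\ge 1$. For an arrow pattern $\alpha=(\nu;H)$ with $\nu=\nu_1\cdots\nu_m$ and $H=\{b_i\to c_i:1\le i\le t\}$, the reverse of $\alpha$ is the arrow pattern $\alpha^r=(\nu_m\nu_{m-1}\cdots\nu_1;\{c_i\to b_i:1\le i\le t\})$. -}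

module Defs where

open import Data.Bool using (if_then_else_)
open import Data.Fin using (Fin; zero; suc; _<_; _<?_; _≟_; punchIn)
open import Data.Fin.Properties using (any?; injective⇒≤; punchIn-injective)
open import Data.Fin.Permutation using (Permutation′; _⟨$⟩ʳ_; _≈_; id; insert; remove; insert-punchIn; insert-remove)
open import Data.List using (List; []; _∷_; [_]; _∷ʳ_; map; foldr; filter; length; lookup; reverse; tabulate; allFin; cartesianProductWith)
open import Data.List.Membership.DecPropositional using (_∈?_)
open import Data.List.Membership.Propositional using (_∈_; _∉_)
open import Data.List.Membership.Propositional.Properties using (∈-allFin; ∈-lookup)
open import Data.List.NonEmpty using (List⁺; _∷_)
open import Data.List.Properties using (≡-dec)
import Data.List.Relation.Binary.Permutation.Setoid as Perm
import Data.List.Relation.Binary.Permutation.Setoid.Properties as Permₚ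
open import Data.List.Relation.Unary.All as All using (All; all?; []; _∷_)
import Data.List.Relation.Unary.All.Properties as Allₚ
open import Data.List.Relation.Unary.AllPairs as AllPairsₗ using ([]; _∷_)
import Data.List.Relation.Unary.AllPairs.Properties as AllPairsₚ
open import Data.List.Relation.Unary.Any as Any using (Any; here)
import Data.List.Relation.Unary.Any.Properties as Anyₚ
open import Data.List.Relation.Unary.Unique.Propositional using (Unique)
open import Data.List.Relation.Unary.Unique.Propositional.Properties using (allFin⁺)
open import Data.Nat as ℕ using (ℕ; zero; suc)
open import Data.Nat.Properties using (1+n≰n)
open import Data.Product using (∃-syntax; _×_; _,_; proj₁; proj₂; swap)
open import Data.Sum as Sum using (_⊎_; inj₁; inj₂)
open import Data.Vec as Vec using (Vec; []; _∷_; toList)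
open import Data.Vec.Relation.Unary.AllPairs as AllPairs using (AllPairs)
open import Function using (_∘_)
open import Relation.Binary.PropositionalEquality using (_≡_; _≢_; refl; sym; trans; cong; subst; setoid)
open import Relation.Nullary using (Dec; does; yes; no; ¬_; ¬?; contradiction; map′; _×-dec_)
open import Relation.Unary using (Decidable)

-- Throughout, [n] is represented by Fin n, so every entry and every
-- position is shifted down by one.

------------------------------------------------------------------------
-- The permutation π̂

-- The word c ∷ cs ++ xs is cut before every left-to-right maximum, where
-- c ∷ cs is the cycle that is still open.  Its first entry c is the
-- largest entry read so far, so x is a left-to-right maximum iff c < x.
cutFrom : ∀ {n} → Fin n → List (Fin n) → List (Fin n) → List (List⁺ (Fin n))
cutFrom c cs []       = [ c ∷ cs ]
cutFrom c cs (x ∷ xs) =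
  if does (c <? x) then (c ∷ cs) ∷ cutFrom x [] xs
                   else cutFrom c (cs ∷ʳ x) xs

cycleForm : ∀ {n} → List (Fin n) → List (List⁺ (Fin n))
cycleForm []       = []
cycleForm (x ∷ xs) = cutFrom x [] xs

-- Each entry of c ∷ cs goes to the one after it, the last entry goes to
-- d, and everything else is fixed.
shift : ∀ {n} → Fin n → Fin n → List (Fin n) → Fin n → Fin n
shift d c []        x = if does (x ≟ c) then d else x
shift d c (c′ ∷ cs) x = if does (x ≟ c) then c′ else shift d c′ cs x

cycle : ∀ {n} → List⁺ (Fin n) → Fin n → Fin n
cycle (c ∷ cs) = shift c c cs

oneLine : ∀ {n} → Permutation′ n → List (Fin n)
oneLine π = tabulate (π ⟨$⟩ʳ_)

-- The cycles are disjoint, so the order of composition is immaterial.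
hat : ∀ {n} → Permutation′ n → Fin n → Fin n
hat π = foldr (λ c f → cycle c ∘ f) (λ x → x) (cycleForm (oneLine π))

------------------------------------------------------------------------
-- Arrow patterns

-- A pattern (ν; H) of size k; the arrow b → c is the pair (b , c), and
-- covers says that the letters of ν and H are all of [k].
record ArrowPattern (k : ℕ) : Set where
  field
    word     : List (Fin k)
    distinct : Unique word
    arrows   : List (Fin k × Fin k)
    covers   : ∀ j → j ∈ word ⊎ Any (λ a → j ≡ proj₁ a ⊎ j ≡ proj₂ a) arrows

open ArrowPattern public

infix 8 _ʳ

_ʳ : ∀ {k} → ArrowPattern k → ArrowPattern k
α ʳ = record
  { word     = reverse (word α)
  ; distinct = Permₚ.Unique-resp-↭ S (Perm.↭-sym S (Permₚ.↭-reverse S (word α))) (distinct α)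
  ; arrows   = map swap (arrows α)
  ; covers   = λ j → Sum.map Anyₚ.reverse⁺ (Anyₚ.map⁺ ∘ Any.map Sum.swap) (covers α j)
  }
  where S = setoid _

-- X = {x₁ < … < xₖ} and t₁ < … < tₘ are given as increasing vectors.
Occurrence : ∀ {n k} → Permutation′ n → (α : ArrowPattern k) →
             Vec (Fin n) k → Vec (Fin n) (length (word α)) → Set
Occurrence π α x t =
    AllPairs _<_ x
  × AllPairs _<_ t
  × map (π ⟨$⟩ʳ_) (toList t) ≡ map (Vec.lookup x) (word α)
  × All (λ a → hat π (Vec.lookup x (proj₁ a)) ≡ Vec.lookup x (proj₂ a)) (arrows α)

Contains : ∀ {n k} → Permutation′ n → ArrowPattern k → Set
Contains π α = ∃[ x ] ∃[ t ] Occurrence π α x t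

Avoids : ∀ {n k} → ArrowPattern k → Permutation′ n → Set
Avoids α π = ¬ Contains π α

anyVec? : ∀ {n m} {P : Vec (Fin n) m → Set} → Decidable P → Dec (∃[ v ] P v)
anyVec? {m = zero}  P? = map′ ([] ,_) (λ { ([] , p) → p }) (P? [])
anyVec? {m = suc m} P? =
  map′ (λ (x , xs , p) → x ∷ xs , p) (λ { (x ∷ xs , p) → x , xs , p })
       (any? λ x → anyVec? λ xs → P? (x ∷ xs))

contains? : ∀ {n k} (π : Permutation′ n) (α : ArrowPattern k) → Dec (Contains π α)
contains? π α = anyVec? λ x → anyVec? λ t →
        AllPairs.allPairs? _<?_ x
  ×-dec AllPairs.allPairs? _<?_ t
  ×-dec ≡-dec _≟_ _ _
  ×-dec all? (λ _ → _ ≟ _) (arrows α)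

avoids? : ∀ {n k} (α : ArrowPattern k) → Decidable (Avoids {n} α)
avoids? α π = ¬? (contains? π α)

------------------------------------------------------------------------
-- Counting

-- A permutation is determined by its first entry and by the relative
-- order of the remaining ones.
permutations : ∀ n → List (Permutation′ n)
permutations zero    = [ id ]
permutations (suc n) =
  cartesianProductWith (insert zero) (allFin (suc n)) (permutations n)

permutations-complete : ∀ {n} (π : Permutation′ n) → Any (π ≈_) (permutations n)
permutations-complete {zero}  π = here λ ()
permutations-complete {suc n} π =
  Anyₚ.cartesianProductWith⁺ (insert zero) combine
    (∈-allFin (π ⟨$⟩ʳ zero)) (permutations-complete (remove zero π))
  where
  combine : ∀ {j ρ} → π ⟨$⟩ʳ zero ≡ j → remove zero π ≈ ρ → π ≈ insert zero j ρ
  combine refl eq zero    = refl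
  combine {ρ = ρ} refl eq (suc i) =
    trans (sym (insert-remove zero π (suc i)))
          (trans (insert-punchIn zero (π ⟨$⟩ʳ zero) (remove zero π) i)
                 (trans (cong (punchIn (π ⟨$⟩ʳ zero)) (eq i))
                        (sym (insert-punchIn zero (π ⟨$⟩ʳ zero) ρ i))))

permutations-distinct : ∀ n → AllPairsₗ.AllPairs (λ π ρ → ¬ π ≈ ρ) (permutations n)
permutations-distinct zero    = [] ∷ []
permutations-distinct (suc n) = go (allFin⁺ (suc n))
  where
  later : ∀ {j js} ρ → All (j ≢_) js → ∀ ρs →
          All (λ σ → ¬ insert zero j ρ ≈ σ) (cartesianProductWith (insert zero) js ρs)
  later ρ j∉ ρs = Allₚ.cartesianProductWith⁺ (setoid _) (setoid _) (insert zero) _ _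
    λ {j′} {ρ′} j′∈ _ eq → All.lookup j∉ j′∈ (eq zero)

  go : ∀ {js} → Unique js →
       AllPairsₗ.AllPairs (λ π ρ → ¬ π ≈ ρ) (cartesianProductWith (insert zero) js (permutations n))
  go []                 = []
  go {j ∷ js} (j∉ ∷ js!) = AllPairsₚ.++⁺
    (AllPairsₚ.map⁺ (AllPairsₗ.map (λ {ρ} {ρ′} ρ≉ρ′ eq → ρ≉ρ′ λ i →
      punchIn-injective j _ _
        (trans (sym (insert-punchIn zero j ρ i))
               (trans (eq (suc i)) (insert-punchIn zero j ρ′ i))))
      (permutations-distinct n)))
    (go js!)
    (Allₚ.map⁺ (All.universal (λ ρ → later ρ j∉ (permutations n)) (permutations n)))

-- |𝒮ₙ(α)|
avoiders : ∀ {k} → ℕ → ArrowPattern k → ℕ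
avoiders n α = length (filter (avoids? α) (permutations n))

infix 4 _∼_

_∼_ : ∀ {k l} → ArrowPattern k → ArrowPattern l → Set
α ∼ β = ∀ n → 1 ℕ.≤ n → avoiders n α ≡ avoiders n β

------------------------------------------------------------------------
-- Patterns whose word omits a single letter

lookup-injective : ∀ {A : Set} {xs : List A} → Unique xs →
                   ∀ {i j} → lookup xs i ≡ lookup xs j → i ≡ j
lookup-injective (x∉ ∷ xs!) {zero}  {zero}  eq = refl
lookup-injective {xs = _ ∷ xs} (x∉ ∷ xs!) {zero}  {suc j} eq =
  contradiction eq (All.lookup x∉ (∈-lookup j))
lookup-injective {xs = _ ∷ xs} (x∉ ∷ xs!) {suc i} {zero}  eq =
  contradiction (sym eq) (All.lookup x∉ (∈-lookup i))
lookup-injective (x∉ ∷ xs!) {suc i} {suc j} eq = cong suc (lookup-injective xs! eq)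

missing-unique : ∀ {k} {ν : List (Fin k)} {r} → Unique ν → suc (length ν) ≡ k → r ∉ ν →
                 ∀ {j} → j ∉ ν → j ≡ r
missing-unique {ν = ν} {r} ν! len r∉ν {j} j∉ν with j ≟ r
... | yes j≡r = j≡r
... | no  j≢r = contradiction
  (subst (suc (suc (length ν)) ℕ.≤_) (sym len) (injective⇒≤ (lookup-injective jrν!)))
  1+n≰n
  where
  jrν! : Unique (j ∷ r ∷ ν)
  jrν! = (j≢r ∷ Allₚ.¬Any⇒All¬ ν j∉ν) ∷ Allₚ.¬Any⇒All¬ ν r∉ν ∷ ν!

-- The pattern (ν; r → νᵢ); its size is k because r is the only letter
-- of [k] missing from ν.
arrowPattern : ∀ {k} (ν : List (Fin k)) → Unique ν → suc (length ν) ≡ k →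
               (r : Fin k) → r ∉ ν → Fin (length ν) → ArrowPattern k
arrowPattern ν ν! len r r∉ν i = record
  { word     = ν
  ; distinct = ν!
  ; arrows   = [ r , lookup ν i ]
  ; covers   = cov
  }
  where
  cov : ∀ j → j ∈ ν ⊎ Any (λ a → j ≡ proj₁ a ⊎ j ≡ proj₂ a) [ r , lookup ν i ]
  cov j with _∈?_ _≟_ j ν
  ... | yes j∈ν = inj₁ j∈ν
  ... | no  j∉ν = inj₂ (here (inj₁ (missing-unique ν! len r∉ν j∉ν)))

{-# OPTIONS --safe #-}

-- Reversing words is a bijection from the avoiders of α to those of αʳ.
-- Let b < a, and let some entry larger than a come after b in π.  The first
-- entry of a cycle is its largest, so b is not one when a is in its cycle,
-- and π̂(a) = b iff "ab" is a factor of π.  In the reversed word ρ the larger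
-- entry comes before b, so a is not a left-to-right maximum if it comes after
-- b, nor the first entry of b's cycle, and ρ̂(b) = a iff "ba" is a factor
-- of ρ.  In the proposition a letter of ν after νᵢ plays the larger entry.

module Submission where

open import Defs
open import Data.Bool using (true; false)
open import Data.Fin using (Fin; zero; suc; toℕ; _<_; _≤_; _<?_; _≟_; opposite)
import Data.Fin.Permutation as Perm
open import Data.Fin.Permutation using (Permutation′; _⟨$⟩ʳ_; _⟨$⟩ˡ_; _≈_; _∘ₚ_; inverseʳ)
open import Data.Fin.Properties using (≤-refl; <-trans; <-irrefl; <-asym; <-cmp; opposite-prop; opposite-involutive; toℕ<n; injective⇒≤)
open import Data.List using (List; []; _∷_; _∷ʳ_; _++_; head; foldr; tabulate; map; reverse; length; lookup; drop; filter)
open import Data.List.Extrema.Nat using (max; argmax-sel)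
open import Data.List.Membership.Propositional using (_∈_; _∉_; lose; find)
open import Data.List.Membership.Propositional.Properties using (∈-filter⁺; ∈-lookup)
open import Data.List.NonEmpty using (List⁺)
open import Data.List.Properties using (∷-injective; ∷ʳ-++; map-∘; map-cong; length-map; reverse-map; reverse-involutive; unfold-reverse)
open import Data.List.Relation.Unary.All as All using (All; []; _∷_)
import Data.List.Relation.Unary.All.Properties as Allₚ
open import Data.List.Relation.Unary.AllPairs as AllPairs using (AllPairs; []; _∷_)
import Data.List.Relation.Unary.AllPairs.Properties as AllPairsₚ
open import Data.List.Relation.Unary.Any as Any using (Any; here; there)
import Data.List.Relation.Unary.Any.Properties as Anyₚ
open import Data.List.Relation.Unary.Unique.Propositional using (Unique)
open import Data.List.Relation.Unary.Unique.Propositional.Properties using (tabulate⁺; Unique[x∷xs]⇒x∉xs)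
open import Data.Maybe using (just; fromMaybe)
open import Data.Maybe.Properties using (just-injective)
open import Data.Nat as ℕ using (ℕ; suc)
open import Data.Nat.Properties as ℕₚ using (≮⇒≥)
open import Data.Product using (_×_; _,_; proj₁; proj₂; ∃-syntax)
open import Data.Sum using (inj₁; inj₂)
open import Data.Vec as Vec using (Vec; toList; fromList)
open import Data.Vec.Properties using (toList∘fromList)
import Data.Vec.Relation.Unary.All.Properties as VecAllₚ
open import Data.Vec.Relation.Unary.AllPairs as VecAllPairs using ([]; _∷_)
open import Function using (_∘_; _⇔_; mk⇔; Equivalence; Injection)
open import Function.Properties.Inverse using (↔⇒↣)
open import Relation.Binary.Definitions using (tri<; tri≈; tri>)
open import Relation.Binary.PropositionalEquality using (_≡_; refl; sym; trans; cong; subst; subst₂)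
open import Relation.Nullary using (¬_; yes; no; contradiction; does; proof; ofʸ; ofⁿ)
open import Relation.Nullary.Decidable using (dec-true; dec-false)

private variable
  A : Set
  n : ℕ
  c d x y z : Fin n
  cs us vs xs ps rest : List (Fin n)

-- Images under the product of the cycles cut from a word.

Unique-++⁻ʳ : ∀ (xs : List A) {ys} → Unique (xs ++ ys) → Unique ys
Unique-++⁻ʳ []       u       = u
Unique-++⁻ʳ (_ ∷ xs) (_ ∷ u) = Unique-++⁻ʳ xs u

Unique-++⇒∉ : ∀ (xs : List A) {ys} → Unique (xs ++ ys) → All (_∉ xs) ys
Unique-++⇒∉ []       _       = All.universal (λ _ ()) _
Unique-++⇒∉ (x ∷ xs) (p ∷ u) =
  All.zipWith (λ { (x≢y , y∉xs) → λ { (here y≡x) → x≢y (sym y≡x) ; (there y∈xs) → y∉xs y∈xs } })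
              (Allₚ.++⁻ʳ xs p , Unique-++⇒∉ xs u)

composeCycles : List (List⁺ (Fin n)) → Fin n → Fin n
composeCycles = foldr (λ c f → cycle c ∘ f) (λ x → x)

-- Used with `P` as non-membership in an earlier cycle: images under the later cycles then stay
-- outside it.
shift-preserves : ∀ {P : Fin n → Set} cs → P d → All P cs → P x → P (shift d c cs x)
shift-preserves {x = x} {c = c} [] pd _ px with x ≟ c
... | yes _ = pd
... | no  _ = px
shift-preserves {x = x} {c = c} (c′ ∷ cs) pd (pc′ ∷ pcs) px with x ≟ c
... | yes _ = pc′
... | no  _ = shift-preserves cs pd pcs px

shift-fixes : ∀ cs → x ∉ c ∷ cs → shift d c cs x ≡ x
shift-fixes {x = x} {c = c} [] x∉ with x ≟ c
... | yes x≡c = contradiction (here x≡c) x∉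
... | no  _   = refl
shift-fixes {x = x} {c = c} (_ ∷ cs) x∉ with x ≟ c
... | yes x≡c = contradiction (here x≡c) x∉
... | no  _   = shift-fixes cs (x∉ ∘ there)

-- The default `d` covers an `x` that closes the cycle. It is kept apart from `c` because the
-- recursion moves `c` along the cycle.
shift-next : ∀ us cs → c ∷ cs ≡ us ++ x ∷ vs → x ∉ us → shift d c cs x ≡ fromMaybe d (head vs)
shift-next {x = x} [] [] refl _ rewrite dec-true (x ≟ x) refl = refl
shift-next {x = x} [] (_ ∷ _) refl _ rewrite dec-true (x ≟ x) refl = refl
shift-next (_ ∷ []) [] () _
shift-next (_ ∷ _ ∷ _) [] () _
shift-next {x = x} (u ∷ us) (c′ ∷ cs) eq x∉ with ∷-injective eq
... | refl , eq′ rewrite dec-false (x ≟ u) (x∉ ∘ here) = shift-next us cs eq′ (x∉ ∘ there)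

-- Here and below c <? y is split into does and proof, since does (c <? y)
-- reduces past c <? y and would not be abstracted by a with on the latter.
cutFrom-preserves : ∀ {P : Fin n → Set} cs xs → P c → All P cs → All P xs → P x →
                    P (composeCycles (cutFrom c cs xs) x)
cutFrom-preserves cs [] pc pcs _ px = shift-preserves cs pc pcs px
cutFrom-preserves {c = c} cs (y ∷ xs) pc pcs (py ∷ pxs) px with does (c <? y) | proof (c <? y)
... | true  | ofʸ _ = shift-preserves cs pc pcs (cutFrom-preserves [] xs py [] pxs px)
... | false | ofⁿ _ = cutFrom-preserves (cs ∷ʳ y) xs pc (Allₚ.∷ʳ⁺ pcs py) pxs px

∷ʳ∷-split : ∀ us (x y : A) vs {ws} → ws ≡ us ++ x ∷ vs → ws ∷ʳ y ≡ us ++ x ∷ (vs ∷ʳ y)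
∷ʳ∷-split []       x y vs refl = refl
∷ʳ∷-split (u ∷ us) x y vs refl = cong (u ∷_) (∷ʳ∷-split us x y vs refl)

cutFrom-fixes : ∀ cs xs → x ∉ c ∷ cs → x ∉ xs → composeCycles (cutFrom c cs xs) x ≡ x
cutFrom-fixes cs [] x∉ _ = shift-fixes cs x∉
cutFrom-fixes {c = c} cs (y ∷ xs) x∉ x∉xs with does (c <? y) | proof (c <? y)
... | true  | ofʸ _ = trans (cong (shift c c cs) (cutFrom-fixes [] xs (λ { (here x≡y) → x∉xs (here x≡y) }) (x∉xs ∘ there)))
                    (shift-fixes cs x∉)
... | false | ofⁿ _ = cutFrom-fixes (cs ∷ʳ y) xs x∉′ (x∉xs ∘ there)
  where
  x∉′ : _ ∉ c ∷ cs ∷ʳ y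
  x∉′ x∈ with Anyₚ.++⁻ (c ∷ cs) x∈
  ... | inj₁ x∈cs        = x∉ x∈cs
  ... | inj₂ (here x≡y) = x∉xs (here x≡y)

-- Entries still to be read are appended behind `z` or form later cycles, which fix `x`; so the
-- successor of `x` in the open cycle is final.
cutFrom-inside : ∀ us cs xs → c ∷ cs ≡ us ++ x ∷ z ∷ vs → x ∉ us → x ∉ xs →
                 composeCycles (cutFrom c cs xs) x ≡ z
cutFrom-inside us cs [] eq x∉us _ = shift-next us cs eq x∉us
cutFrom-inside {c = c} {x = x} us cs (y ∷ xs) eq x∉us x∉xs with does (c <? y) | proof (c <? y)
... | true  | ofʸ _ = trans (cong (shift c c cs) (cutFrom-fixes [] xs (λ { (here x≡y) → x∉xs (here x≡y) }) (x∉xs ∘ there)))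
                    (shift-next us cs eq x∉us)
... | false | ofⁿ _ = cutFrom-inside us (cs ∷ʳ y) xs (∷ʳ∷-split us x y _ eq) x∉us (x∉xs ∘ there)

-- If the cycle closes after `x`, then `x` goes to `c`, and a next entry, if any, exceeds `c`;
-- neither is `y`, so both sides fail. Otherwise the next entry joins the cycle and is the image of
-- `x`.
cutFrom-last : ∀ us cs rest → c ∷ cs ≡ us ∷ʳ x → x ∉ us → x ∉ rest → y < c →
               composeCycles (cutFrom c cs rest) x ≡ y ⇔ head rest ≡ just y
cutFrom-last {c = c} us cs [] eq x∉us _ y<c rewrite shift-next {d = c} us cs eq x∉us =
  mk⇔ (λ { refl → contradiction y<c (<-irrefl refl) }) λ ()
cutFrom-last {c = c} {x = x} us cs (z ∷ rest) eq x∉us x∉rest y<c with does (c <? z) | proof (c <? z)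
... | true  | ofʸ c<z rewrite cutFrom-fixes {c = z} [] rest (λ { (here x≡z) → x∉rest (here x≡z) }) (x∉rest ∘ there)
                    | shift-next {d = c} us cs eq x∉us =
  mk⇔ (λ { refl → contradiction y<c (<-irrefl refl) })
      (λ { refl → contradiction y<c (<-asym c<z) })
... | false | ofⁿ _ rewrite cutFrom-inside us (cs ∷ʳ z) rest (∷ʳ∷-split us x z [] eq) x∉us (x∉rest ∘ there) =
  mk⇔ (cong just) just-injective

-- Reading on to `x` keeps an entry above `y` among `c` and the entries up to `x`: each one read
-- either replaces `c` by something larger or is bounded by `c`. So the first entry of the cycle of
-- `x` exceeds `y`, as `cutFrom-last` requires.
cutFrom-reach : ∀ cs ps → Unique ((c ∷ cs) ++ ps ++ x ∷ rest) → Any (y <_) (c ∷ ps ∷ʳ x) →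
                composeCycles (cutFrom c cs (ps ++ x ∷ rest)) x ≡ y ⇔ head rest ≡ just y
cutFrom-reach {c = c} {x = x} {rest = rest} {y = y} cs [] u y<
  with Unique-++⇒∉ (c ∷ cs) u | Unique[x∷xs]⇒x∉xs (Unique-++⁻ʳ (c ∷ cs) u) | does (c <? x) | proof (c <? x)
... | x∉cs ∷ rest∉cs | x∉rest | true  | ofʸ c<x
  -- The cycle closed before `x` is applied last, to an image outside it, so it drops out.
  rewrite shift-fixes {d = c} cs (cutFrom-preserves {P = _∉ c ∷ cs} [] rest x∉cs [] rest∉cs x∉cs) =
  cutFrom-last [] [] rest refl (λ ()) x∉rest (y<x y<)
  where
  y<x : Any (y <_) (c ∷ x ∷ []) → y < x
  y<x (here y<c)         = <-trans y<c c<x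
  y<x (there (here y<x)) = y<x
... | x∉cs ∷ _ | x∉rest | false | ofⁿ c≮x = cutFrom-last (c ∷ cs) (cs ∷ʳ x) rest refl x∉cs x∉rest (y<c y<)
  where
  y<c : Any (y <_) (c ∷ x ∷ []) → y < c
  y<c (here y<c)         = y<c
  y<c (there (here y<x)) = ℕₚ.<-≤-trans y<x (≮⇒≥ c≮x)
cutFrom-reach {c = c} {x = x} {rest = rest} {y = y} cs (p ∷ ps) u y<
  with Unique-++⇒∉ (c ∷ cs) u | does (c <? p) | proof (c <? p)
... | p∉cs ∷ later∉cs | true  | ofʸ c<p
  rewrite shift-fixes {d = c} cs (cutFrom-preserves {P = _∉ c ∷ cs} [] (ps ++ x ∷ rest) p∉cs [] later∉cs
            (All.head (Allₚ.++⁻ʳ ps later∉cs))) =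
  cutFrom-reach [] ps (Unique-++⁻ʳ (c ∷ cs) u) (drop-c y<)
  where
  drop-c : Any (y <_) (c ∷ p ∷ ps ∷ʳ x) → Any (y <_) (p ∷ ps ∷ʳ x)
  drop-c (here y<c)  = here (<-trans y<c c<p)
  drop-c (there y<p) = y<p
... | _ | false | ofⁿ c≮p =
  cutFrom-reach (cs ∷ʳ p) ps (subst Unique (sym (∷ʳ-++ (c ∷ cs) p _)) u) (drop-p y<)
  where
  drop-p : Any (y <_) (c ∷ p ∷ ps ∷ʳ x) → Any (y <_) (c ∷ ps ∷ʳ x)
  drop-p (here y<c)          = here y<c
  drop-p (there (here y<p))  = here (ℕₚ.<-≤-trans y<p (≮⇒≥ c≮p))
  drop-p (there (there y<))  = there y<

cycleForm-next : ∀ ps → Unique (ps ++ x ∷ rest) → Any (y <_) (ps ∷ʳ x) →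
                 composeCycles (cycleForm (ps ++ x ∷ rest)) x ≡ y ⇔ head rest ≡ just y
cycleForm-next {rest = rest} [] u (here y<x) =
  cutFrom-last [] [] rest refl (λ ()) (Unique[x∷xs]⇒x∉xs u) y<x
cycleForm-next (p ∷ ps) u y< = cutFrom-reach [] ps u y<

-- From words to positions: `hat` and adjacent entries.

infix 4 _Precedes_

_Precedes_ : Fin n → Fin n → Set
p Precedes q = toℕ q ≡ suc (toℕ p)

tabulate-split : (f : Fin n → A) (p : Fin n) → ∃[ ps ] ∃[ rest ]
  tabulate f ≡ ps ++ f p ∷ rest ×
  (∀ {m} → m ≤ p → f m ∈ ps ∷ʳ f p) ×
  (∀ {y} → head rest ≡ just y ⇔ (∃[ q ] p Precedes q × f q ≡ y))
tabulate-split {n = suc ℕ.zero} f zero =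
  [] , [] , refl , (λ { {zero} _ → here refl }) , mk⇔ (λ ()) λ { (zero , () , _) }
tabulate-split {n = suc (suc n)} f zero =
  [] , tabulate (f ∘ suc) , refl , (λ { {zero} _ → here refl }) ,
  mk⇔ (λ { refl → suc zero , refl , refl }) λ { (suc zero , refl , refl) → refl }
tabulate-split f (suc p) with tabulate-split (f ∘ suc) p
... | ps , rest , eq , before , next =
  f zero ∷ ps , rest , cong (f zero ∷_) eq ,
  (λ { {zero} _ → here refl ; {suc m} (ℕ.s≤s m≤p) → there (before m≤p) }) ,
  mk⇔ (λ h → let q , p→q , fq≡y = Equivalence.to next h in suc q , cong suc p→q , fq≡y)
      (λ { (suc q , p→q , fq≡y) → Equivalence.from next (q , ℕₚ.suc-injective p→q , fq≡y) })

-- The cycle containing the entry at `p` begins with the largest entry up to `p`, hence with one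
-- above `y`. So `y` can neither be reached by closing that cycle nor begin the next one.
hat-next : ∀ (π : Permutation′ n) {m p} → m ≤ p → y < π ⟨$⟩ʳ m →
           hat π (π ⟨$⟩ʳ p) ≡ y ⇔ (∃[ q ] p Precedes q × π ⟨$⟩ʳ q ≡ y)
hat-next {y = y} π {m} {p} m≤p y<πm
  with oneLine π | tabulate⁺ {f = π ⟨$⟩ʳ_} (Injection.injective (↔⇒↣ π)) | tabulate-split (π ⟨$⟩ʳ_) p
... | _ | u | ps , rest , refl , before , next =
  mk⇔ (Equivalence.to next ∘ Equivalence.to cyc) (Equivalence.from cyc ∘ Equivalence.from next)
  where
  cyc = cycleForm-next ps u (lose (before m≤p) y<πm)

-- Reversal of permutations.

-- A relation rather than a map, because `permutations n` holds the reverse of `π` only up to `≈`.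
record Reversed {n} (π ρ : Permutation′ n) : Set where
  constructor reversed
  field
    at-opposite : ∀ i → ρ ⟨$⟩ʳ opposite i ≡ π ⟨$⟩ʳ i

open Reversed

Reversed-sym : ∀ {π ρ : Permutation′ n} → Reversed π ρ → Reversed ρ π
Reversed-sym {ρ = ρ} rev = reversed λ i →
  trans (sym (at-opposite rev (opposite i))) (cong (ρ ⟨$⟩ʳ_) (opposite-involutive i))

opposite-< : ∀ {i j : Fin n} → i < j → opposite j < opposite i
opposite-< {i = i} {j} i<j rewrite opposite-prop i | opposite-prop j =
  ℕₚ.∸-monoʳ-< (ℕ.s≤s i<j) (toℕ<n j)

opposite-Precedes : ∀ {p q : Fin n} → p Precedes q → opposite q Precedes opposite p
opposite-Precedes {n = n} {p} {q} p→q rewrite opposite-prop p | opposite-prop q | p→q =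
  -- The truncated subtraction is exact because the position after `p` is still below `n`.
  ℕₚ.+-∸-assoc 1 (subst (ℕ._< n) p→q (toℕ<n q))

-- The larger entry that `hat-next` asks for is `x` itself in `π`, and in `ρ` the entry from
-- position `m`, which reversal moves to the front. Both sides become adjacency statements that
-- mirror each other.
hat-Reversed : ∀ {π ρ : Permutation′ n} {p m} → Reversed π ρ → p < m →
               π ⟨$⟩ʳ p < x → x < π ⟨$⟩ʳ m →
               hat π x ≡ π ⟨$⟩ʳ p ⇔ hat ρ (π ⟨$⟩ʳ p) ≡ x
hat-Reversed {n = n} {x = x} {π = π} {ρ} {p} {m} rev p<m πp<x x<πm = mk⇔ to from
  where
  s : Fin n
  s = π ⟨$⟩ˡ x
  πs≡x : π ⟨$⟩ʳ s ≡ x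
  πs≡x = inverseʳ π

  π-next : hat π (π ⟨$⟩ʳ s) ≡ π ⟨$⟩ʳ p ⇔ (∃[ q ] s Precedes q × π ⟨$⟩ʳ q ≡ π ⟨$⟩ʳ p)
  π-next = hat-next π ≤-refl (subst (π ⟨$⟩ʳ p <_) (sym πs≡x) πp<x)

  ρ-next : hat ρ (ρ ⟨$⟩ʳ opposite p) ≡ x ⇔ (∃[ q ] opposite p Precedes q × ρ ⟨$⟩ʳ q ≡ x)
  ρ-next = hat-next ρ (ℕₚ.<⇒≤ (opposite-< p<m)) (subst (x <_) (sym (at-opposite rev m)) x<πm)

  to : hat π x ≡ π ⟨$⟩ʳ p → hat ρ (π ⟨$⟩ʳ p) ≡ x
  to h with Equivalence.to π-next (trans (cong (hat π) πs≡x) h)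
  ... | q , s→q , πq≡πp with Injection.injective (↔⇒↣ π) πq≡πp
  ... | refl = subst (λ v → hat ρ v ≡ x) (at-opposite rev p)
    (Equivalence.from ρ-next (opposite s , opposite-Precedes s→q , trans (at-opposite rev s) πs≡x))

  from : hat ρ (π ⟨$⟩ʳ p) ≡ x → hat π x ≡ π ⟨$⟩ʳ p
  from h with Equivalence.to ρ-next (trans (cong (hat ρ) (at-opposite rev p)) h)
  ... | q , p→q , ρq≡x = trans (cong (hat π) (sym πs≡x)) (Equivalence.from π-next (p , s→p , refl))
    where
    q≡s : opposite q ≡ s
    q≡s = Injection.injective (↔⇒↣ π) (trans (at-opposite (Reversed-sym rev) q) (trans ρq≡x (sym πs≡x)))
    s→p : s Precedes p
    s→p = subst₂ _Precedes_ q≡s (opposite-involutive p) (opposite-Precedes p→q)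

-- Occurrences of a pattern and their reversal.

AllPairs-reverse⁺ : ∀ {R : A → A → Set} {xs} → AllPairs R xs → AllPairs (λ x y → R y x) (reverse xs)
AllPairs-reverse⁺ [] = []
AllPairs-reverse⁺ {xs = x ∷ xs} (px ∷ pxs) =
  subst (AllPairs _) (sym (unfold-reverse x xs))
    (AllPairsₚ.++⁺ (AllPairs-reverse⁺ pxs) ([] ∷ [])
      (All.tabulate (λ y∈ → All.lookup px (Anyₚ.reverse⁻ y∈) ∷ [])))

-- Positions form a list, not a vector, since the lengths of a word and its reverse agree only up to
-- a proof.
Spells : Permutation′ n → List (Fin n) → List (Fin n) → Set
Spells π ts ws = AllPairs _<_ ts × map (π ⟨$⟩ʳ_) ts ≡ ws

Spells-reverse : ∀ {π ρ : Permutation′ n} {ts ws} → Reversed π ρ → Spells π ts ws →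
                 Spells ρ (reverse (map opposite ts)) (reverse ws)
Spells-reverse {ts = ts} rev (ts↗ , refl) =
  AllPairs-reverse⁺ (AllPairsₚ.map⁺ (AllPairs.map opposite-< ts↗)) ,
  trans (reverse-map _ (map opposite ts))
        (cong reverse (trans (sym (map-∘ ts)) (map-cong (at-opposite rev) ts)))

toList-AllPairs⁺ : ∀ {R : A → A → Set} {m} {v : Vec A m} → VecAllPairs.AllPairs R v → AllPairs R (toList v)
toList-AllPairs⁺ []       = []
toList-AllPairs⁺ (p ∷ ps) = VecAllₚ.toList⁺ p ∷ toList-AllPairs⁺ ps

fromList-AllPairs⁺ : ∀ {R : A → A → Set} {xs} → AllPairs R xs → VecAllPairs.AllPairs R (fromList xs)
fromList-AllPairs⁺ []       = []
fromList-AllPairs⁺ (p ∷ ps) = VecAllₚ.fromList⁺ p ∷ fromList-AllPairs⁺ ps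

AllPairs-lookup : ∀ {R : A → A → Set} {m} {v : Vec A m} → VecAllPairs.AllPairs R v →
                  ∀ {i j} → i < j → R (Vec.lookup v i) (Vec.lookup v j)
AllPairs-lookup (p ∷ ps) {zero}  {suc j} _           = VecAllₚ.lookup⁺ p j
AllPairs-lookup (p ∷ ps) {suc i} {suc j} (ℕ.s≤s i<j) = AllPairs-lookup ps i<j

module _ {n k} (π : Permutation′ n) (α : ArrowPattern k) where

  private
    Arrows : Vec (Fin n) k → Set
    Arrows x = All (λ a → hat π (Vec.lookup x (proj₁ a)) ≡ Vec.lookup x (proj₂ a)) (arrows α)

  Contains⇔Spells : Contains π α ⇔
    (∃[ x ] VecAllPairs.AllPairs _<_ x × (∃[ ts ] Spells π ts (map (Vec.lookup x) (word α))) × Arrows x)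
  Contains⇔Spells = mk⇔
    (λ (x , t , x↗ , t↗ , eq , as) → x , x↗ , (toList t , toList-AllPairs⁺ t↗ , eq) , as)
    (λ { (x , x↗ , (ts , ts↗ , eq) , as) →
         let t , t↗ , eq′ = resize x ts ts↗ eq in x , t , x↗ , t↗ , eq′ , as })
    where
    resize : ∀ x ts → AllPairs _<_ ts → map (π ⟨$⟩ʳ_) ts ≡ map (Vec.lookup x) (word α) →
             ∃[ t ] VecAllPairs.AllPairs _<_ {n = length (word α)} t ×
                    map (π ⟨$⟩ʳ_) (toList t) ≡ map (Vec.lookup x) (word α)
    -- The length of the vector is recovered from the word spelled.
    resize x ts ts↗ eq = subst
      (λ m → ∃[ t ] VecAllPairs.AllPairs _<_ {n = m} t × map (π ⟨$⟩ʳ_) (toList t) ≡ map (Vec.lookup x) (word α))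
      (trans (sym (length-map _ ts)) (trans (cong length eq) (length-map _ (word α))))
      (fromList ts , fromList-AllPairs⁺ ts↗ , trans (cong (map _) (toList∘fromList ts)) eq)

-- Carries a letter after the `i`-th over to the occurrence: positions increase along `ν`, so `m`
-- lies beyond `p`.
later-position : ∀ {B C : Set} {f : Fin n → C} {g : B → C} {P : B → Set} {ts} ν (i : Fin (length ν)) →
                 AllPairs _<_ ts → map f ts ≡ map g ν → Any P (drop (suc (toℕ i)) ν) →
                 ∃[ p ] ∃[ m ] ∃[ j ] p < m × f p ≡ g (lookup ν i) × f m ≡ g j × P j
later-position {f = f} {g} {P} {t ∷ ts} (b ∷ ν) zero (t< ∷ _) eq Pν =
  let fp≡ , eq′ = ∷-injective eq
      m , j , t<m , fm≡ , Pj = go ts ν t< eq′ Pν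
  in t , m , j , t<m , fp≡ , fm≡ , Pj
  where
  go : ∀ ts ν → All (t <_) ts → map f ts ≡ map g ν → Any P ν → ∃[ m ] ∃[ j ] t < m × f m ≡ g j × P j
  go (m ∷ _) (j ∷ _) (t<m ∷ _) eq (here Pj) = m , j , t<m , proj₁ (∷-injective eq) , Pj
  go (_ ∷ ts) (_ ∷ ν) (_ ∷ t<) eq (there Pν) = go ts ν t< (proj₂ (∷-injective eq)) Pν
later-position {ts = t ∷ ts} (b ∷ ν) (suc i) (_ ∷ ts↗) eq Pν =
  later-position ν i ts↗ (proj₂ (∷-injective eq)) Pν

-- The default 0 is never above `m`, so the maximum is attained by a letter.
max-witness : ∀ {m} xs → m ℕ.< max 0 (map toℕ xs) → Any (λ (j : Fin n) → m ℕ.< toℕ j) xs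
max-witness {m = m} xs m<max with argmax-sel (λ v → v) 0 (map toℕ xs)
... | inj₁ max≡0 = contradiction (subst (m ℕ.<_) max≡0 m<max) λ ()
... | inj₂ max∈  = Any.map (λ eq → subst (m ℕ.<_) eq m<max) (Anyₚ.map⁻ max∈)

module _ {k} {ν : List (Fin k)} (ν! : Unique ν) (len : suc (length ν) ≡ k) {r} (r∉ν : r ∉ ν) (i : Fin (length ν))
         (νᵢ<r : lookup ν i < r) (larger : Any (r <_) (drop (suc (toℕ i)) ν)) where

  private
    α = arrowPattern ν ν! len r r∉ν i

  arrow-Reversed : ∀ {π ρ : Permutation′ n} {x ts} → Reversed π ρ → VecAllPairs.AllPairs _<_ x →
                   Spells π ts (map (Vec.lookup x) ν) →
                   hat π (Vec.lookup x r) ≡ Vec.lookup x (lookup ν i) ⇔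
                   hat ρ (Vec.lookup x (lookup ν i)) ≡ Vec.lookup x r
  arrow-Reversed {π = π} {ρ} {x} rev x↗ (ts↗ , eq) with later-position ν i ts↗ eq larger
  ... | p , m , j , p<m , πp≡ , πm≡ , r<j = subst
    (λ b → hat π (Vec.lookup x r) ≡ b ⇔ hat ρ b ≡ Vec.lookup x r) πp≡
    (hat-Reversed rev p<m
      (subst (_< Vec.lookup x r) (sym πp≡) (AllPairs-lookup x↗ νᵢ<r))
      (subst (Vec.lookup x r <_) (sym πm≡) (AllPairs-lookup x↗ r<j)))

  -- The same values `x` serve both sides; positions are reflected and `arrow-Reversed` turns the
  -- only arrow round.
  Contains-Reversed : ∀ {π ρ : Permutation′ n} → Reversed π ρ → Contains π α ⇔ Contains ρ (α ʳ)
  Contains-Reversed {π = π} {ρ} rev = mk⇔ (Equivalence.from ρ-spells ∘ to ∘ Equivalence.to π-spells)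
                                            (Equivalence.from π-spells ∘ from ∘ Equivalence.to ρ-spells)
    where
    π-spells = Contains⇔Spells π α
    ρ-spells = Contains⇔Spells ρ (α ʳ)
    to : _ → _
    to (x , x↗ , (ts , sp) , h ∷ []) =
      x , x↗ , (_ , subst (Spells ρ _) (sym (reverse-map _ ν)) (Spells-reverse rev sp)) ,
      Equivalence.to (arrow-Reversed rev x↗ sp) h ∷ []
    from : _ → _
    from (x , x↗ , (ts , sp) , h ∷ []) =
      x , x↗ , (_ , sp′) , Equivalence.from (arrow-Reversed rev x↗ sp′) h ∷ []
      where
      -- `arrow-Reversed` takes an occurrence of `ν` in `π`, so the one in `ρ` is reflected back
      -- first.
      sp′ = subst (Spells π _) (trans (sym (reverse-map _ (reverse ν))) (cong (map _) (reverse-involutive ν)))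
                  (Spells-reverse (Reversed-sym rev) sp)

-- Counting the avoiders.

List-AllPairs-lookup : ∀ {R : A → A → Set} {xs} → AllPairs R xs → ∀ {i j} → i < j → R (lookup xs i) (lookup xs j)
List-AllPairs-lookup (p ∷ ps) {zero}  {suc j} _           = All.lookup p (∈-lookup j)
List-AllPairs-lookup (p ∷ ps) {suc i} {suc j} (ℕ.s≤s i<j) = List-AllPairs-lookup ps i<j

-- Pigeonhole on indices: entries of `xs` sharing an image in `ys` are related by `≈`, which
-- distinct indices exclude.
length-≤ : ∀ {B : Set} {_≈_ : A → A → Set} {R : A → B → Set} {xs ys} →
           AllPairs (λ x x′ → ¬ (x ≈ x′)) xs → (∀ {x x′ y} → R x y → R x′ y → x ≈ x′) →
           All (λ x → Any (R x) ys) xs → length xs ℕ.≤ length ys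
length-≤ {A = A} {_≈_ = _≈_} {R} {xs} {ys} xs! R-inj images = injective⇒≤ inj
  where
  image : ∀ i → Any (R (lookup xs i)) ys
  image i = All.lookup images (∈-lookup i)

  clash : ∀ {i j} → Any.index (image i) ≡ Any.index (image j) → lookup xs i ≈ lookup xs j
  clash {i} {j} eq = R-inj (Anyₚ.lookup-index (image i))
    (subst (λ l → R (lookup xs j) (lookup ys l)) (sym eq) (Anyₚ.lookup-index (image j)))

  inj : ∀ {i j} → Any.index (image i) ≡ Any.index (image j) → i ≡ j
  inj {i} {j} eq with <-cmp i j
  ... | tri< i<j _ _ = contradiction (clash eq) (List-AllPairs-lookup xs! i<j)
  ... | tri≈ _ i≡j _ = i≡j
  ... | tri> _ _ j<i = contradiction (clash (sym eq)) (List-AllPairs-lookup xs! j<i)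

avoiders-≤ : ∀ {k l} (α : ArrowPattern k) (β : ArrowPattern l) →
             (∀ {π ρ : Permutation′ n} → Reversed π ρ → Contains ρ β → Contains π α) →
             avoiders n α ℕ.≤ avoiders n β
avoiders-≤ {n = n} α β reflects =
  length-≤ {_≈_ = _≈_} {R = Reversed}
    (AllPairsₚ.filter⁺ (avoids? α) (permutations-distinct n))
    (λ rev rev′ i → trans (sym (at-opposite rev i)) (at-opposite rev′ i))
    (All.map image (Allₚ.all-filter (avoids? α) (permutations n)))
  where
  image : ∀ {π} → Avoids α π → Any (Reversed π) (filter (avoids? β) (permutations n))
  -- `∘ₚ` applies its left factor first, so this reverses positions; `ρ` is the representative in
  -- the list.
  image {π} avoids with find (permutations-complete (Perm.reverse ∘ₚ π))
  ... | ρ , ρ∈ , πʳ≈ρ = lose (∈-filter⁺ (avoids? β) ρ∈ (avoids ∘ reflects rev)) rev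
    where
    rev : Reversed π ρ
    rev = reversed λ i → trans (sym (πʳ≈ρ (opposite i))) (cong (π ⟨$⟩ʳ_) (opposite-involutive i))

proposition2p6 : ∀ {k : ℕ} (ν : List (Fin k)) (ν-distinct : Unique ν) (ν-length : suc (length ν) ≡ k)
    (r : Fin k) (r∉ν : r ∉ ν) (i : Fin (length ν)) →
    lookup ν i < r →
    toℕ r ℕ.< max 0 (map toℕ (drop (suc (toℕ i)) ν)) →
    arrowPattern ν ν-distinct ν-length r r∉ν i ∼ arrowPattern ν ν-distinct ν-length r r∉ν i ʳ
proposition2p6 ν ν! len r r∉ν i νᵢ<r r<max n _ = ℕₚ.≤-antisym
  (avoiders-≤ α (α ʳ) (Equivalence.from ∘ contains-reversed))
  -- Symmetry of `Reversed` gives the converse inequality from the same equivalence.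
  (avoiders-≤ (α ʳ) α (Equivalence.to ∘ contains-reversed ∘ Reversed-sym))
  where
  α = arrowPattern ν ν! len r r∉ν i

  contains-reversed : ∀ {π ρ : Permutation′ n} → Reversed π ρ → Contains π α ⇔ Contains ρ (α ʳ)
  contains-reversed = Contains-Reversed ν! len r∉ν i νᵢ<r (max-witness _ r<max)
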